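{- There is a constant $c$ such that the following holds. Let $n\in\mathbb N$, $f:\mathbb B^n\to\mathbb B$, and let $X\in\mathrm{IS}_{br}$ compute $f$. Then there exists $Y\in\mathrm{IS}_{br}$ in which the basic instruction $\mathrm{out}.\mathrm{set}{:}F$ does not occur (in any plain, positive test or negative test instruction) such that $Y$ computes $f$ and $|Y|\le c\cdot|X|$.
   Context: $\mathbb B=\{T,F\}$. A primitive instruction is one of: a plain basic instruction $a$, a positive test instruction $+a$, a negative test instruction $-a$ (for a basic instruction $a$), a forward jump instruction $\#l$ ($l\in\mathbb N$), or the termination instruction $!$. An instruction sequence is a finite nonempty sequence $X=u_1;\dots;u_k$ of primitive instructions; its length is $|X|=k$. Basic instructions have the form $f.m$ where the focus $f$ is one of $\mathrm{in}{:}i$, $\mathrm{aux}{:}i$ ($i\ge 1$) or $\mathrm{out}$, each naming a Boolean register, and the method $m$ is one of $\mathrm{set}{:}T$, $\mathrm{set}{:}F$, $\mathrm{get}$. Executing $f.\mathrm{set}{:}b$ sets register $f$ to $b$ and yields reply $b$; executing $f.\mathrm{get}$ leaves the register unchanged and yields its content as reply. Execution of $X=u_1;\dots;u_k$: a counter starts at $1$. If the counter exceeds $k$, execution deadlocks. At position $i$: if $u_i=!$, execution terminates; if $u_i=\#l$, execution deadlocks if $l=0$ and otherwise the counter becomes $i+l$; if $u_i$ is $a$, $+a$ or $-a$, the basic instruction $a$ is executed yielding reply $r$, and the counter becomes $i+1$ for $u_i=a$; for $u_i=+a$ it becomes $i+1$ if $r=T$ and $i+2$ if $r=F$; for $u_i=-a$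 it becomes $i+1$ if $r=F$ and $i+2$ if $r=T$. $\mathrm{IS}_{br}$ is the set of instruction sequences in which every basic instruction occurring belongs to $\{f.\mathrm{get}: f=\mathrm{in}{:}i \text{ or } f=\mathrm{aux}{:}i\}\cup\{f.\mathrm{set}{:}b: f=\mathrm{aux}{:}i \text{ or } f=\mathrm{out},\ b\in\mathbb B\}$. $X\in\mathrm{IS}_{br}$ computes $f:\mathbb B^n\to\mathbb B$ if for every $(b_1,\dots,b_n)\in\mathbb B^n$: when $X$ is executed with register $\mathrm{in}{:}j$ initialised to $b_j$ ($j\le n$) and all registers $\mathrm{aux}{:}i$ and $\mathrm{out}$ initialised to $F$, execution terminates (does not deadlock) without ever executing a basic instruction with focus $\mathrm{in}{:}j$ for $j>n$, and at termination register $\mathrm{out}$ contains $f(b_1,\dots,b_n)$. -}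

module Defs where

open import Data.Bool.Base using (Bool; true; false; if_then_else_)
open import Data.Fin.Base using (Fin; toℕ)
open import Data.List.Base using (List; []; _∷_; head; drop)
open import Data.List.NonEmpty.Base using (List⁺; toList)
open import Data.List.Relation.Unary.All using (All)
open import Data.List.Relation.Unary.Any using (Any)
open import Data.Maybe.Base using (Maybe; just; nothing)
open import Data.Nat.Base using (ℕ; zero; suc; _+_; _≤_; NonZero)
import Data.Nat.Properties as ℕ
open import Data.Product.Base using (_×_; ∃₂)
open import Data.Vec.Base using (Vec; lookup)
open import Relation.Binary.Definitions using (DecidableEquality)
open import Relation.Binary.PropositionalEquality using (_≡_; refl; cong)
open import Relation.Nullary.Decidable using (yes; no; does; map′)

-- Register indices start at 1.  The index constraint is irrelevant, so two
-- foci are equal as soon as their indices are.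
data Focus : Set where
  in:  : (i : ℕ) .{{_ : NonZero i}} → Focus
  aux: : (i : ℕ) .{{_ : NonZero i}} → Focus
  out  : Focus

private
  index : Focus → ℕ
  index (in: i)  = i
  index (aux: i) = i
  index out      = 0

_≟ᶠ_ : DecidableEquality Focus
in: i  ≟ᶠ in: j  = map′ (λ { refl → refl }) (cong index) (i ℕ.≟ j)
in: i  ≟ᶠ aux: j = no λ ()
in: i  ≟ᶠ out    = no λ ()
aux: i ≟ᶠ in: j  = no λ ()
aux: i ≟ᶠ aux: j = map′ (λ { refl → refl }) (cong index) (i ℕ.≟ j)
aux: i ≟ᶠ out    = no λ ()
out    ≟ᶠ in: j  = no λ ()
out    ≟ᶠ aux: j = no λ ()
out    ≟ᶠ out    = yes refl

data Method : Set where
  set: : Bool → Method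
  get  : Method

infix 8 _∙_
infix 7 +_ -_ #_

record Basic : Set where
  constructor _∙_
  field
    focus  : Focus
    method : Method

open Basic public

data Primitive : Set where
  plain : Basic → Primitive
  +_    : Basic → Primitive
  -_    : Basic → Primitive
  #_    : ℕ → Primitive
  !     : Primitive

InstrSeq : Set
InstrSeq = List⁺ Primitive

data _OccursInPrimitive_ (a : Basic) : Primitive → Set where
  in-plain : a OccursInPrimitive plain a
  in-+     : a OccursInPrimitive (+ a)
  in--     : a OccursInPrimitive (- a)

_OccursIn_ : Basic → InstrSeq → Set
a OccursIn X = Any (a OccursInPrimitive_) (toList X)

data BrInstruction : Basic → Set where
  in-get  : ∀ i .{{_ : NonZero i}} → BrInstruction (in: i ∙ get)
  aux-get : ∀ i .{{_ : NonZero i}} → BrInstruction (aux: i ∙ get)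
  aux-set : ∀ i .{{_ : NonZero i}} b → BrInstruction (aux: i ∙ set: b)
  out-set : ∀ b → BrInstruction (out ∙ set: b)

ISbr : InstrSeq → Set
ISbr X = ∀ a → a OccursIn X → BrInstruction a

State : Set
State = Focus → Bool

_[_≔_] : State → Focus → Bool → State
(s [ f ≔ b ]) g = if does (f ≟ᶠ g) then b else s g

reply : Basic → State → Bool
reply (f ∙ set: b) s = b
reply (f ∙ get)    s = s f

effect : Basic → State → State
effect (f ∙ set: b) s = s [ f ≔ b ]
effect (f ∙ get)    s = s

-- Positions are counted from 1.
_at_ : InstrSeq → ℕ → Maybe Primitive
X at zero  = nothing
X at suc i = head (drop i (toList X))

-- Run X i s as s′: execution of X with the counter at i and register contents
-- s terminates with register contents s′, having executed exactly the basic
-- instructions as, in this order.  Deadlock, by #0 or by a counter past the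
-- end of X, is the absence of a rule.
data Run (X : InstrSeq) : ℕ → State → List Basic → State → Set where
  halt : ∀ {i s} →
    X at i ≡ just ! →
    Run X i s [] s
  jump : ∀ {i l s as s′} →
    X at i ≡ just (# suc l) →
    Run X (i + suc l) s as s′ →
    Run X i s as s′
  basic : ∀ {i a s as s′} →
    X at i ≡ just (plain a) →
    Run X (i + 1) (effect a s) as s′ →
    Run X i s (a ∷ as) s′
  test+ : ∀ {i a s as s′} →
    X at i ≡ just (+ a) →
    Run X (i + (if reply a s then 1 else 2)) (effect a s) as s′ →
    Run X i s (a ∷ as) s′
  test- : ∀ {i a s as s′} →
    X at i ≡ just (- a) →
    Run X (i + (if reply a s then 2 else 1)) (effect a s) as s′ →
    Run X i s (a ∷ as) s′

-- The registers in:j with j > n are left unconstrained.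
record Initial {n : ℕ} (bs : Vec Bool n) (s : State) : Set where
  field
    in-init  : ∀ (j : Fin n) → s (in: (suc (toℕ j))) ≡ lookup bs j
    aux-init : ∀ i .{{_ : NonZero i}} → s (aux: i) ≡ false
    out-init : s out ≡ false

InputsWithin : ℕ → Basic → Set
InputsWithin n a = ∀ j .{{_ : NonZero j}} → focus a ≡ in: j → j ≤ n

_Computes_ : InstrSeq → ∀ {n} → (Vec Bool n → Bool) → Set
_Computes_ X {n} f = ∀ (bs : Vec Bool n) (s : State) → Initial bs s →
  ∃₂ λ as s′ → Run X 1 s as s′ × All (InputsWithin n) as × s′ out ≡ f bs

{-# OPTIONS --safe #-}

-- Let aux:k be an auxiliary register that X does not use.  In X, let aux:k play
-- the role of out, and replace every ! by a jump to just behind the last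
-- instruction, where the three instructions +aux:k.get; out.set:T; ! are
-- appended.  These copy aux:k to out, because out still contains F when they
-- are reached.  All positions of X are preserved, so a run of X is simulated
-- step by step, and |Y| = |X| + 3 ≤ 4 |X|.
module Submission where

open import Data.Bool.Base using (Bool; true; false; if_then_else_)
open import Data.List.Base as List using (List; []; _∷_; head; drop)
open import Data.List.Membership.Propositional using (_∈_; lose)
open import Data.List.NonEmpty.Base using (length; toList; _∷_)
open import Data.List.Relation.Unary.All using (All; []; _∷_)
open import Data.List.Relation.Unary.Any using (Any; here; there)
open import Data.Maybe.Base using (just)
open import Data.Nat.Base using (ℕ; zero; suc; _+_; _*_; _≤_; _⊔_; NonZero)
open import Data.Nat.Properties
  using (+-identityʳ; +-assoc; +-monoʳ-≤; m≤m*n; ≤-refl; ≤-trans; m≤m⊔n; m≤n⊔m; 1+n≰n)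
open import Data.Product.Base using (_×_; _,_; ∃₂; ∃-syntax)
open import Data.Sum.Base using (_⊎_; inj₁; inj₂)
open import Data.Vec.Base using (Vec)
open import Function.Base using (_∘_)
open import Relation.Binary.PropositionalEquality
  using (_≡_; _≢_; refl; sym; trans; cong; subst)
open import Relation.Nullary.Decidable using (yes; no; dec-true; dec-false)
open import Relation.Nullary.Negation using (¬_; contradiction)
open import Defs

update-same : ∀ s f b → (s [ f ≔ b ]) f ≡ b
update-same s f b rewrite dec-true (f ≟ᶠ f) refl = refl

update-other : ∀ s {f g} b → f ≢ g → (s [ f ≔ b ]) g ≡ s g
update-other s {f} {g} b f≢g rewrite dec-false (f ≟ᶠ g) f≢g = refl

head-drop-∈ : ∀ {A : Set} (i : ℕ) {xs : List A} {x} →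
  head (drop i xs) ≡ just x → x ∈ xs
head-drop-∈ zero    {x ∷ xs} refl = here refl
head-drop-∈ (suc i) {x ∷ xs} eq   = there (head-drop-∈ i eq)

aux-index-bound : ∀ us → ∃[ m ] (∀ i .{{_ : NonZero i}} a →
  focus a ≡ aux: i → Any (a OccursInPrimitive_) us → i ≤ m)
aux-index-bound []       = 0 , λ _ _ _ ()
aux-index-bound (u ∷ us) with primitive-bound u | aux-index-bound us
  where
  basic-bound : ∀ a → ∃[ m ] (∀ i .{{_ : NonZero i}} → focus a ≡ aux: i → i ≤ m)
  basic-bound (in: i ∙ _)  = 0 , λ _ ()
  basic-bound (aux: i ∙ _) = i , λ { _ refl → ≤-refl }
  basic-bound (out ∙ _)    = 0 , λ _ ()

  primitive-bound : ∀ u → ∃[ m ] (∀ i .{{_ : NonZero i}} a →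
    focus a ≡ aux: i → a OccursInPrimitive u → i ≤ m)
  primitive-bound (plain a) with m , p ← basic-bound a = m , λ { i _ eq in-plain → p i eq }
  primitive-bound (+ a)     with m , p ← basic-bound a = m , λ { i _ eq in-+ → p i eq }
  primitive-bound (- a)     with m , p ← basic-bound a = m , λ { i _ eq in-- → p i eq }
  primitive-bound (# l)     = 0 , λ _ _ _ ()
  primitive-bound !         = 0 , λ _ _ _ ()
... | m , p | m′ , p′ = m ⊔ m′ , λ
  { i a eq (here  o) → ≤-trans (p  i a eq o) (m≤m⊔n m m′)
  ; i a eq (there o) → ≤-trans (p′ i a eq o) (m≤n⊔m m m′) }

module _ (k : ℕ) .{{_ : NonZero k}} where

  renameᶠ : Focus → Focus
  renameᶠ out = aux: k
  renameᶠ f   = f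

  rename : Basic → Basic
  rename (f ∙ m) = renameᶠ f ∙ m

  -- The only collision is that `out` and `aux: k` are both sent to `aux: k`; the two hypotheses
  -- exclude it.
  renameᶠ-injective : ∀ {f g} → f ≢ aux: k → g ≢ aux: k → renameᶠ f ≡ renameᶠ g → f ≡ g
  renameᶠ-injective {in: _}  {in: _}  _ _  refl = refl
  renameᶠ-injective {aux: _} {aux: _} _ _  refl = refl
  renameᶠ-injective {aux: _} {out}    p _  eq   = contradiction eq p
  renameᶠ-injective {out}    {aux: _} _ q  eq   = contradiction (sym eq) q
  renameᶠ-injective {out}    {out}    _ _  _    = refl

  -- This serves twice: it keeps `out ∙ set: false` out of the translation, and it keeps `out` at F
  -- until the epilogue is reached.
  renameᶠ≢out : ∀ f → renameᶠ f ≢ out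
  renameᶠ≢out (in: _)  ()
  renameᶠ≢out (aux: _) ()
  renameᶠ≢out out      ()

  rename-Br : ∀ {a} → BrInstruction a → BrInstruction (rename a)
  rename-Br (in-get i)    = in-get i
  rename-Br (aux-get i)   = aux-get i
  rename-Br (aux-set i b) = aux-set i b
  rename-Br (out-set b)   = aux-set k b

  rename-InputsWithin : ∀ {n} a → InputsWithin n a → InputsWithin n (rename a)
  rename-InputsWithin (in: _ ∙ _)  w = w
  rename-InputsWithin (aux: _ ∙ _) w = w
  rename-InputsWithin (out ∙ _)    w = λ _ ()

  -- d is the number of instructions following the translated one.
  translateᵖ : ℕ → Primitive → Primitive
  translateᵖ d (plain a) = plain (rename a)
  translateᵖ d (+ a)     = + rename a
  translateᵖ d (- a)     = - rename a
  translateᵖ d (# l)     = # l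
  translateᵖ d !         = # suc d

  epilogue : List Primitive
  epilogue = + (aux: k ∙ get) ∷ plain (out ∙ set: true) ∷ ! ∷ []

  translateˡ : List Primitive → List Primitive
  translateˡ []       = epilogue
  translateˡ (u ∷ us) = translateᵖ (List.length us) u ∷ translateˡ us

  -- Repeats the cons clause of `translateˡ`, so that the result is nonempty by construction.
  translate : InstrSeq → InstrSeq
  translate (u ∷ us) = translateᵖ (List.length us) u ∷ translateˡ us

  toList-translate : ∀ X → toList (translate X) ≡ translateˡ (toList X)
  toList-translate (u ∷ us) = refl

  length-translateˡ : ∀ us → List.length (translateˡ us) ≡ List.length us + 3
  length-translateˡ []       = refl
  length-translateˡ (u ∷ us) = cong suc (length-translateˡ us)

  length-translate : ∀ X → length (translate X) ≡ length X + 3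
  length-translate (u ∷ us) = cong suc (length-translateˡ us)

  occurs-translateᵖ : ∀ {a d} u → a OccursInPrimitive translateᵖ d u →
    ∃[ b ] (b OccursInPrimitive u × a ≡ rename b)
  occurs-translateᵖ (plain b) in-plain = b , in-plain , refl
  occurs-translateᵖ (+ b)     in-+     = b , in-+ , refl
  occurs-translateᵖ (- b)     in--     = b , in-- , refl

  occurs-translateˡ : ∀ {a} us → Any (a OccursInPrimitive_) (translateˡ us) →
    (∃[ b ] (Any (b OccursInPrimitive_) us × a ≡ rename b)) ⊎
    a ≡ aux: k ∙ get ⊎ a ≡ out ∙ set: true
  occurs-translateˡ [] (here in-+)             = inj₂ (inj₁ refl)
  occurs-translateˡ [] (there (here in-plain)) = inj₂ (inj₂ refl)
  occurs-translateˡ [] (there (there (here ())))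
  occurs-translateˡ (u ∷ us) (here o) with b , o′ , eq ← occurs-translateᵖ u o =
    inj₁ (b , here o′ , eq)
  occurs-translateˡ (u ∷ us) (there o) with occurs-translateˡ us o
  ... | inj₁ (b , o′ , eq) = inj₁ (b , there o′ , eq)
  ... | inj₂ eqs           = inj₂ eqs

  occurs-translate : ∀ {a} X → a OccursIn translate X →
    (∃[ b ] (b OccursIn X × a ≡ rename b)) ⊎
    a ≡ aux: k ∙ get ⊎ a ≡ out ∙ set: true
  occurs-translate X o rewrite toList-translate X = occurs-translateˡ (toList X) o

  translate-ISbr : ∀ X → ISbr X → ISbr (translate X)
  translate-ISbr X br a o with occurs-translate X o
  ... | inj₁ (b , o′ , refl) = rename-Br (br b o′)
  ... | inj₂ (inj₁ refl)     = aux-get k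
  ... | inj₂ (inj₂ refl)     = out-set true

  translate-no-out-set-F : ∀ X → ¬ ((out ∙ set: false) OccursIn translate X)
  translate-no-out-set-F X o with occurs-translate X o
  ... | inj₁ (b , _ , eq) = renameᶠ≢out (focus b) (sym (cong focus eq))
  ... | inj₂ (inj₁ ())
  ... | inj₂ (inj₂ ())

  at-translateˡ : ∀ i us {u} → head (drop i us) ≡ just u →
    ∃[ d ] (i + suc d ≡ List.length us ×
            head (drop i (translateˡ us)) ≡ just (translateᵖ d u))
  at-translateˡ zero    (u ∷ us) refl = List.length us , refl , refl
  at-translateˡ (suc i) (u ∷ us) eq with d , p , q ← at-translateˡ i us eq =
    d , cong suc p , q

  at-epilogueˡ : ∀ us j → head (drop (List.length us + j) (translateˡ us)) ≡ head (drop j epilogue)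
  at-epilogueˡ []       j = refl
  at-epilogueˡ (u ∷ us) j = at-epilogueˡ us j

  -- The equation for `d` says that the jump `# suc d`, which replaces a `!` at position `i`, lands
  -- on the first instruction of the epilogue.
  at-translate : ∀ X i {u} → X at i ≡ just u →
    ∃[ d ] (i + suc d ≡ suc (length X) × translate X at i ≡ just (translateᵖ d u))
  at-translate X@(_ ∷ _) (suc i) eq with d , p , q ← at-translateˡ i (toList X) eq =
    d , cong suc p , q

  at-epilogue : ∀ X j → translate X at suc (length X + j) ≡ head (drop j epilogue)
  at-epilogue X@(_ ∷ _) j = at-epilogueˡ (toList X) j

  -- Here `s` belongs to the run of `X` and `t` to the run of its translation. At `out`, `agree`
  -- says that `aux: k` in `t` holds what `out` holds in `s`; the content of `aux: k` in `s` is left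
  -- open.
  record _Simulates_ (t s : State) : Set where
    field
      agree : ∀ {f} → f ≢ aux: k → t (renameᶠ f) ≡ s f
      out-F : t out ≡ false

  open _Simulates_

  effect-Simulates : ∀ {t s} a → focus a ≢ aux: k → t Simulates s →
    effect (rename a) t Simulates effect a s
  effect-Simulates         (f ∙ get)    fresh sim = sim
  effect-Simulates {t} {s} (f ∙ set: b) fresh sim = record
    { agree = agree′
    ; out-F = trans (update-other t b (renameᶠ≢out f)) (out-F sim)
    }
    where
    agree′ : ∀ {g} → g ≢ aux: k → (t [ renameᶠ f ≔ b ]) (renameᶠ g) ≡ (s [ f ≔ b ]) g
    agree′ {g} g≢ with f ≟ᶠ g
    ... | yes refl = update-same t (renameᶠ f) b
    -- Distinct registers other than `aux: k` stay distinct after renaming, so the write to one does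
    -- not disturb the other.
    ... | no  f≢g  = trans (update-other t b (f≢g ∘ renameᶠ-injective fresh g≢)) (agree sim g≢)

  reply-Simulates : ∀ {t s} a → focus a ≢ aux: k → t Simulates s →
    reply (rename a) t ≡ reply a s
  reply-Simulates (f ∙ get)    fresh sim = agree sim fresh
  reply-Simulates (f ∙ set: _) fresh sim = refl

  -- One state can serve both runs, because `out` and `aux: k` both start with F.
  Initial-Simulates : ∀ {n} {bs : Vec Bool n} {s} → Initial bs s → s Simulates s
  Initial-Simulates init = record
    { agree = λ { {in: _} _ → refl
                ; {aux: _} _ → refl
                ; {out} _ → trans (aux-init k) (sym out-init) }
    ; out-F = out-init
    }
    where open Initial init

  -- The conclusion of `_Computes_`, freed from the initial counter and state so that induction on a
  -- run can carry it.
  Terminates : ℕ → InstrSeq → ℕ → State → Bool → Set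
  Terminates n Y i t b = ∃₂ λ as t′ → Run Y i t as t′ × All (InputsWithin n) as × t′ out ≡ b

  epilogue-Terminates : ∀ {n t s} X → t Simulates s →
    Terminates n (translate X) (suc (length X)) t (s out)
  -- The tested bit is passed along with an equation, so that splitting on it fixes both the branch
  -- taken and the value required of `out`.
  epilogue-Terminates {n} {t} {s} X sim = copy (t (aux: k)) refl
    where
    enter : ∀ {b as t′} → t (aux: k) ≡ b →
      Run (translate X) (suc (length X) + (if b then 1 else 2)) t as t′ →
      Run (translate X) (suc (length X)) t (aux: k ∙ get ∷ as) t′
    enter refl = test+ (trans
      (cong (λ i → translate X at suc i) (sym (+-identityʳ (length X)))) (at-epilogue X 0))

    copy : ∀ b → t (aux: k) ≡ b → Terminates n (translate X) (suc (length X)) t (s out)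
    copy true  eq = _ , _ ,
      enter eq (basic (at-epilogue X 1)
        (subst (λ i → Run (translate X) (suc i) (t [ out ≔ true ]) [] (t [ out ≔ true ]))
          (sym (+-assoc (length X) 1 1))
          (halt (at-epilogue X 2)))) ,
      (λ _ ()) ∷ (λ _ ()) ∷ [] ,
      trans (update-same t out true) (trans (sym eq) (agree sim {out} λ ()))
    -- The test skips the assignment and goes straight to `!`; the F that `out-F` guarantees is
    -- already the correct result.
    copy false eq = _ , _ ,
      enter eq (halt (at-epilogue X 2)) ,
      (λ _ ()) ∷ [] ,
      trans (out-F sim) (trans (sym eq) (agree sim {out} λ ()))

  Fresh : InstrSeq → Set
  Fresh X = ∀ a → a OccursIn X → focus a ≢ aux: k

  fresh-at : ∀ {i u a} X → Fresh X → X at i ≡ just u → a OccursInPrimitive u → focus a ≢ aux: k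
  fresh-at {suc i} {a = a} X fresh eq o = fresh a (lose (head-drop-∈ i eq) o)

  -- Induction on the run of `X`. The counters coincide at every step because translation preserves
  -- positions; only the final content of `out` is compared, since the epilogue alters the
  -- translated state.
  simulate : ∀ {n i s as s′ t} X → Fresh X → Run X i s as s′ → All (InputsWithin n) as →
    t Simulates s → Terminates n (translate X) i t (s′ out)
  -- Where `X` halts, the translation jumps to the epilogue, and `p` identifies the target of that
  -- jump.
  simulate {i = i} {t = t} X fresh (halt eq) [] sim
    with d , p , q ← at-translate X i eq
    with as , t′ , r , w , e ← epilogue-Terminates X sim =
    as , t′ , jump q (subst (λ j → Run (translate X) j t as t′) (sym p) r) , w , e
  simulate {i = i} X fresh (jump eq run) ws sim
    with _ , _ , q ← at-translate X i eq
    with as , t′ , r , w , e ← simulate X fresh run ws sim =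
    as , t′ , jump q r , w , e
  simulate {i = i} X fresh (basic {a = a} eq run) (v ∷ ws) sim
    with _ , _ , q ← at-translate X i eq
    with as , t′ , r , w , e ←
      simulate X fresh run ws (effect-Simulates a (fresh-at {i} X fresh eq in-plain) sim) =
    _ , t′ , basic q r , rename-InputsWithin a v ∷ w , e
  simulate {i = i} X fresh (test+ {a = a} eq run) (v ∷ ws) sim
    with _ , _ , q ← at-translate X i eq
    with as , t′ , r , w , e ←
      simulate X fresh run ws (effect-Simulates a (fresh-at {i} X fresh eq in-+) sim) =
    _ , t′ ,
    -- The run given by induction branches on the reply in the original state; equal replies let it
    -- continue the translated test.
    test+ q (subst (λ b → Run (translate X) (i + (if b then 1 else 2)) _ as t′)
      (sym (reply-Simulates a (fresh-at {i} X fresh eq in-+) sim)) r) ,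
    rename-InputsWithin a v ∷ w , e
  simulate {i = i} X fresh (test- {a = a} eq run) (v ∷ ws) sim
    with _ , _ , q ← at-translate X i eq
    with as , t′ , r , w , e ←
      simulate X fresh run ws (effect-Simulates a (fresh-at {i} X fresh eq in--) sim) =
    _ , t′ ,
    test- q (subst (λ b → Run (translate X) (i + (if b then 2 else 1)) _ as t′)
      (sym (reply-Simulates a (fresh-at {i} X fresh eq in--) sim)) r) ,
    rename-InputsWithin a v ∷ w , e

  translate-Computes : ∀ {n} {f : Vec Bool n → Bool} X → Fresh X → X Computes f → translate X Computes f
  translate-Computes X fresh comp bs s init
    with as , s′ , run , ws , e ← comp bs s init
    with as′ , t′ , run′ , ws′ , e′ ← simulate X fresh run ws (Initial-Simulates init) =
    as′ , t′ , run′ , ws′ , trans e′ e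

theorem4 : ∃[ c ] (∀ (n : ℕ) (f : Vec Bool n → Bool) (X : InstrSeq) →
    ISbr X → X Computes f →
    ∃[ Y ] (ISbr Y × ¬ ((out ∙ set: false) OccursIn Y) ×
    Y Computes f × length Y ≤ c * length X))
theorem4 = 4 , λ n f X br comp →
  let m , bound = aux-index-bound (toList X)
      -- One more than every auxiliary index in `X`, hence fresh, and nonzero as register indices
      -- must be.
      k = suc m
  in translate k X
   , translate-ISbr k X br
   , translate-no-out-set-F k X
   , translate-Computes k X (λ a o eq → 1+n≰n (bound k a eq o)) comp
   , length-bound k X
  where
  length-bound : ∀ k .{{_ : NonZero k}} X → length (translate k X) ≤ 4 * length X
  -- `4 * length X` unfolds to `length X + 3 * length X`. The cons pattern exposes the length as a
  -- successor, which gives `3 ≤ 3 * length X`.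
  length-bound k X@(_ ∷ _) rewrite length-translate k X =
    +-monoʳ-≤ (length X) (m≤m*n 3 (length X))
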